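{- Let $T$ be an optimal 2WCST for an instance of $n\ge 3$ keys, where $v_0$ is the root of $T$ and $v_1$ is the root of the main branch of $v_0$. Then $$sw(v_0)+sw(v_1)\ \ge\ \tfrac12\, w(T).$$
   Context: An instance is a finite linearly ordered set $\mathcal K$ of $n$ keys, each key $k$ having a weight $w_k\ge 0$. A two-way comparison search tree (2WCST) for $\mathcal K$ is a rooted binary decision tree whose leaves are in bijection with the keys of $\mathcal K$ and in which each internal node is labelled either with an equal-to test $\langle =k\rangle$ ("is $q=k$?") or a less-than test $\langle <k\rangle$ ("is $q<k$?") for a key $k\in\mathcal K$, and has two children, one for the answer "yes" (left) and one for the answer "no" (right). It is required that for each query $q\in\mathcal K$, the search starting at the root ends in the leaf labelled $q$. The cost of $T$ is $\sum_{k}w_k\cdot \mathrm{depth}(k)$, where $\mathrm{depth}(k)$ is the number of comparison nodes on the path from the root to leaf $k$; $T$ is optimal if its cost is minimum among all 2WCSTs for the instance. The weight $w(T)$ of a (sub)tree is the sum of the weights of the keys in its leaves. The side-weight $sw(v)$ of a node $v$ is: $0$ if $v$ is a leaf; $w_k$ if $v$ is an equal-to test on key $k$; and $\min\{w(T_L),w(T_R)\}$ if $v$ is a less-than test with left and right subtrees $T_L,T_R$. The side branch of a comparison node $v$ is the leaf $k$ if $v$ is the equal-to test $\langle =k\rangle$, and is the subtree of $v$ of least weight if $v$ is a less-than test (ties broken arbitrarily). The other branch of $v$ is its main branch.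
   Formalization: Added assumption: if the root v_0 is a less-than test, its main branch is not a single leaf. Without it the claim is false: keys 1<2<3 with weights 100,1,1 and root test <2 give sw(v_0)+sw(v_1)=2<51. -}

module Defs where

open import Algebra.Bundles using (CommutativeRing)
open import Data.Bool.Base using (Bool; if_then_else_)
open import Data.Fin.Base using (Fin)
open import Data.Fin.Properties using (_≟_; _<?_)
open import Data.List.Base using (List; [_]; _++_; allFin)
open import Data.List.Relation.Binary.Permutation.Propositional using (_↭_)
open import Data.Nat.Base using (ℕ; zero; suc)
open import Data.Product.Base using (_×_)
open import Level using (Level; _⊔_) renaming (suc to lsuc)
open import Relation.Binary.Bundles using (DecTotalOrder)
open import Relation.Binary.Core using (Rel)
open import Relation.Binary.PropositionalEquality.Core using (_≡_)
open import Relation.Binary.Structures using (IsDecTotalOrder)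
open import Relation.Nullary.Decidable.Core using (does)

-- Weights live in an arbitrary ordered field.  Classically, ℝ is an instance;
-- so is ℚ.
record OrderedField (c ℓ₁ ℓ₂ : Level) : Set (lsuc (c ⊔ ℓ₁ ⊔ ℓ₂)) where
  field
    commutativeRing : CommutativeRing c ℓ₁
  open CommutativeRing commutativeRing public
  infix 4 _≤_
  infix 8 _⁻¹
  field
    _≤_             : Rel Carrier ℓ₂
    isDecTotalOrder : IsDecTotalOrder _≈_ _≤_
    +-monoˡ-≤       : ∀ {x y} z → x ≤ y → x + z ≤ y + z
    *-nonneg        : ∀ {x y} → 0# ≤ x → 0# ≤ y → 0# ≤ x * y
    1≉0             : 1# ≉ 0#
    -- Total for convenience; the value 0# ⁻¹ is unconstrained.
    _⁻¹             : Carrier → Carrier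
    ⁻¹-inverseʳ     : ∀ {x} → x ≉ 0# → x * x ⁻¹ ≈ 1#

  decTotalOrder : DecTotalOrder c ℓ₁ ℓ₂
  decTotalOrder = record { isDecTotalOrder = isDecTotalOrder }

  open DecTotalOrder decTotalOrder public using (totalOrder)
  open import Algebra.Construct.NaturalChoice.Min totalOrder public using (_⊓_)
  open import Algebra.Properties.CommutativeMonoid.Sum +-commutativeMonoid
    public using (sum)
  open import Algebra.Properties.Monoid.Mult +-monoid
    public using () renaming (_×_ to _·_)

  ½ : Carrier
  ½ = (1# + 1#) ⁻¹

-- The linearly ordered set of n keys is Fin n with its usual order.
data Test (n : ℕ) : Set where
  equalTo  : Fin n → Test n
  lessThan : Fin n → Test n

answer : ∀ {n} → Test n → Fin n → Bool
answer (equalTo k)  q = does (q ≟ k)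
answer (lessThan k) q = does (q <? k)

-- In node t l r, the subtree l is for the answer "yes" and r for "no".
data Tree (n : ℕ) : Set where
  leaf : Fin n → Tree n
  node : Test n → Tree n → Tree n → Tree n

leaves : ∀ {n} → Tree n → List (Fin n)
leaves (leaf k)     = [ k ]
leaves (node t l r) = leaves l ++ leaves r

search : ∀ {n} → Tree n → Fin n → Fin n
search (leaf k)     q = k
search (node t l r) q = if answer t q then search l q else search r q

Is2WCST : ∀ {n} → Tree n → Set
Is2WCST {n} T = leaves T ↭ allFin n × (∀ q → search T q ≡ q)

-- The number of comparison nodes on the search path of q; in a 2WCST this is
-- the path from the root to the leaf q.
depth : ∀ {n} → Tree n → Fin n → ℕ
depth (leaf k)     q = zero
depth (node t l r) q = suc (if answer t q then depth l q else depth r q)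

data HasLessThanRoot {n : ℕ} : Tree n → Set where
  lessThanRoot : ∀ {k l r} → HasLessThanRoot (node (lessThan k) l r)

data IsLeaf {n : ℕ} : Tree n → Set where
  isLeaf : ∀ {k} → IsLeaf (leaf k)

module Weighted {c ℓ₁ ℓ₂ : Level} (F : OrderedField c ℓ₁ ℓ₂)
                {n : ℕ} (w : Fin n → OrderedField.Carrier F) where

  open OrderedField F

  cost : Tree n → Carrier
  cost T = sum (λ k → depth T k · w k)

  Optimal : Tree n → Set ℓ₂
  Optimal T = Is2WCST T × (∀ T′ → Is2WCST T′ → cost T ≤ cost T′)

  weight : Tree n → Carrier
  weight (leaf k)     = w k
  weight (node t l r) = weight l + weight r

  -- The side-weight of the root of the given (sub)tree.
  sw : Tree n → Carrier
  sw (leaf k)                = 0#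
  sw (node (equalTo k)  l r) = w k
  sw (node (lessThan k) l r) = weight l ⊓ weight r

  -- Branches T S M: S may be taken as the side branch of the root of T, and
  -- M is then its main branch.  In a 2WCST the "yes" subtree of an equal-to
  -- test on k is the leaf k.  For a less-than test whose subtrees have equal
  -- weight both choices are allowed.
  data Branches : Tree n → Tree n → Tree n → Set ℓ₂ where
    equalTo   : ∀ {k l r} → Branches (node (equalTo k) l r) l r
    sideLeft  : ∀ {k l r} → weight l ≤ weight r →
                Branches (node (lessThan k) l r) l r
    sideRight : ∀ {k l r} → weight r ≤ weight l →
                Branches (node (lessThan k) l r) r l

{-# OPTIONS --safe #-}

-- Let T₂ be the subtree reached from the root by two main branches, and S₀, S₁
-- the side branches passed on the way.  As w(T) = w(S₀) + w(S₁) + w(T₂), the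
-- claim is w(T₂) ≤ w(S₀) + w(S₁).  It follows by comparing T with trees in
-- which the keys of T₂ are found sooner, and only those of S₀ and S₁ later.
-- Such a tree need only search correctly: pruning its unreachable parts does
-- not increase depths.
--
-- In the main case the first four tests split off four disjoint sets σ₀, …, σ₃
-- of keys, each a single key or cut off at an end of the order.  The third of
-- them from the left is a single key, and a less-than test on it leaves two of
-- the sets on each side; asking it first and then, on each side, only the two
-- tests that still matter finds all other keys after three tests, not four.

module Submission where

open import Defs
open import Algebra.Properties.CommutativeSemigroup using (x∙yz≈y∙xz; xy∙z≈xz∙y)
import Data.Bool.Properties as Bool
open import Data.Bool.Base using (true; false; if_then_else_)
open import Data.Fin.Base as Fin using (Fin; zero; suc; toℕ)
open import Data.Fin.Properties using (_≟_; _<?_; toℕ-injective; toℕ<n)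
open import Data.List.Base using (List; []; _∷_; _++_; allFin; filter)
open import Data.List.Membership.Propositional using (_∈_)
open import Data.List.Membership.Propositional.Properties using (∈-allFin; ∈-++⁻; ∈-filter⁻)
open import Data.List.Properties using (++-identityʳ)
open import Data.List.Relation.Binary.Permutation.Propositional
  using (_↭_; refl; prep; swap; trans; ↭-reflexive; ↭-refl; ↭-sym; ↭-trans; ↭-prep)
open import Data.List.Relation.Binary.Permutation.Propositional.Properties
  using (↭-empty-inv; ∈-resp-↭; ++⁺; shift)
open import Data.List.Relation.Unary.All as All using (All; []; _∷_)
open import Data.List.Relation.Unary.AllPairs using ([]; _∷_)
open import Data.List.Relation.Unary.Any using (here; there)
open import Data.List.Relation.Unary.Unique.Propositional using (Unique)
open import Data.List.Relation.Unary.Unique.Propositional.Properties using (allFin⁺; filter⁺)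
open import Data.Nat.Base as ℕ using (ℕ; zero; suc; z≤n; s≤s)
open import Data.Nat.Properties as ℕₚ using (_≤?_)
open import Data.Product.Base using (∃-syntax; _×_; _,_; proj₁; proj₂)
open import Data.Sum.Base using (_⊎_; inj₁; inj₂; [_,_]′)
open import Function.Base using (_∘_)
open import Level using (Level)
open import Relation.Binary.Bundles using (DecTotalOrder)
import Relation.Binary.Reasoning.PartialOrder as ≤-Reasoning
open import Relation.Binary.PropositionalEquality.Core as ≡
  using (_≡_; _≢_; refl; cong; cong₂; subst)
open import Relation.Unary using (Decidable)
open import Relation.Unary.Properties using (∁?)
open import Relation.Nullary.Decidable
  using (Dec; yes; no; does; True; toWitness; dec-true; dec-false)
open import Relation.Nullary.Negation.Core using (¬_; contradiction)

private
  variable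
    n : ℕ

-- Sides: the key sets that one test separates

-- A set of keys that a single test can split off.
data Side (n : ℕ) : Set where
  only below from : Fin n → Side n

infix 4 _∋_ _⊆_

data _∋_ {n : ℕ} : Side n → Fin n → Set where
  only  : ∀ {k} → only k ∋ k
  below : ∀ {k q} → q Fin.< k → below k ∋ q
  from  : ∀ {k q} → k Fin.≤ q → from k ∋ q

only⁻¹ : {k q : Fin n} → only k ∋ q → q ≡ k
only⁻¹ only = refl

_∋?_ : (σ : Side n) (q : Fin n) → Dec (σ ∋ q)
only k ∋? q with q ≟ k
... | yes refl = yes only
... | no  q≢k  = no λ { only → q≢k refl }
below k ∋? q with q <? k
... | yes q<k = yes (below q<k)
... | no  q≮k = no λ { (below q<k) → q≮k q<k }
from k ∋? q with q <? k
... | yes q<k = no λ { (from k≤q) → ℕₚ.<⇒≱ q<k k≤q }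
... | no  q≮k = yes (from (ℕₚ.≮⇒≥ q≮k))

_⊆_ Disjoint : Side n → Side n → Set
σ ⊆ τ        = ∀ {q} → σ ∋ q → τ ∋ q
Disjoint σ τ = ∀ {q} → σ ∋ q → ¬ τ ∋ q

disjoint-sym : {σ τ : Side n} → Disjoint σ τ → Disjoint τ σ
disjoint-sym d τ∋q σ∋q = d σ∋q τ∋q

∌⇒disjoint-only : {σ : Side n} {k : Fin n} → ¬ σ ∋ k → Disjoint σ (only k)
∌⇒disjoint-only σ∌k σ∋k only = σ∌k σ∋k

∌below⇒≥ : {k q : Fin n} → ¬ below k ∋ q → k Fin.≤ q
∌below⇒≥ ∌ = ℕₚ.≮⇒≥ (∌ ∘ below)

∌from⇒< : {k q : Fin n} → ¬ from k ∋ q → q Fin.< k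
∌from⇒< ∌ = ℕₚ.≰⇒> (∌ ∘ from)

below⇒∌from : {k q : Fin n} → below k ∋ q → ¬ from k ∋ q
below⇒∌from (below q<k) (from k≤q) = ℕₚ.<⇒≱ q<k k≤q

from⇒∌below : {k q : Fin n} → from k ∋ q → ¬ below k ∋ q
from⇒∌below = disjoint-sym below⇒∌from

∌below⇒from : {k q : Fin n} → ¬ below k ∋ q → from k ∋ q
∌below⇒from = from ∘ ∌below⇒≥

-- The keys `p` and `q` exclude `τ ⊆ σ` and a cover of the whole order. Segments at the same end are
-- nested, and `p` decides which is the smaller; segments at opposite ends are kept apart by `q`,
-- which lies in the gap between them.
nested-or-disjoint : (σ τ : Side n) {p q : Fin n} →
  ¬ σ ∋ p → τ ∋ p → ¬ σ ∋ q → ¬ τ ∋ q → σ ⊆ τ ⊎ Disjoint σ τ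
nested-or-disjoint (only k) τ _ _ _ _ with τ ∋? k
... | yes τ∋k = inj₁ λ { only → τ∋k }
... | no  τ∌k = inj₂ λ { only → τ∌k }
nested-or-disjoint (below k) (only m) σ∌p only _ _ = inj₂ (∌⇒disjoint-only σ∌p)
nested-or-disjoint (from k) (only m) σ∌p only _ _ = inj₂ (∌⇒disjoint-only σ∌p)
nested-or-disjoint (below k) (below m) σ∌p (below p<m) _ _ =
  inj₁ λ { (below q<k) → below (ℕₚ.<-trans (ℕₚ.<-≤-trans q<k (∌below⇒≥ σ∌p)) p<m) }
nested-or-disjoint (below k) (from m) _ _ σ∌q τ∌q =
  inj₂ λ { (below r<k) (from m≤r) →
    ℕₚ.<⇒≱ (ℕₚ.<-trans (ℕₚ.<-≤-trans r<k (∌below⇒≥ σ∌q)) (∌from⇒< τ∌q)) m≤r }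
nested-or-disjoint (from k) (below m) _ _ σ∌q τ∌q =
  inj₂ λ { (from k≤r) (below r<m) →
    ℕₚ.<⇒≱ (ℕₚ.<-≤-trans r<m (∌below⇒≥ τ∌q)) (ℕₚ.≤-trans (ℕₚ.<⇒≤ (∌from⇒< σ∌q)) k≤r) }
nested-or-disjoint (from k) (from m) σ∌p (from m≤p) _ _ =
  inj₁ λ { (from k≤q) → from (ℕₚ.≤-trans m≤p (ℕₚ.≤-trans (ℕₚ.<⇒≤ (∌from⇒< σ∌p)) k≤q)) }

-- Disjoint sides along the line of keys

-- The position of a side in the line of keys, for pairwise disjoint sides.
rank : Side n → ℕ
rank (below k)    = 0
rank (only k)     = suc (toℕ k)
rank {n} (from k) = suc n

record Nonempty (σ : Side n) : Set where
  constructor _,_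
  field
    element : Fin n
    member  : σ ∋ element

-- Sides of different kinds have ranks in different ranges: 0, 1 to `n`, and `n + 1`. Two nonempty
-- segments at the same end meet, as both contain the extreme key there.
rank-injective : {σ τ : Side n} →
  Disjoint σ τ → Nonempty σ → Nonempty τ → rank σ ≢ rank τ
rank-injective {σ = only k} {only m} d (_ , only) _ eq
  with refl ← toℕ-injective (ℕₚ.suc-injective eq) = d only only
rank-injective {σ = only k} {from m} d _ _ eq = ℕₚ.<⇒≢ (s≤s (toℕ<n k)) eq
rank-injective {σ = from k} {only m} d _ _ eq = ℕₚ.<⇒≢ (s≤s (toℕ<n m)) (≡.sym eq)
rank-injective {σ = below k} {below m} d (p , below p<k) (q , below q<m) eq
  with p <? m
... | yes p<m = d (below p<k) (below p<m)
... | no  p≮m = d (below (ℕₚ.<-trans (ℕₚ.<-≤-trans q<m (ℕₚ.≮⇒≥ p≮m)) p<k)) (below q<m)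
rank-injective {σ = from k} {from m} d (p , from k≤p) (q , from m≤q) eq
  with p <? m
... | yes p<m = d (from (ℕₚ.≤-trans k≤p (ℕₚ.≤-trans (ℕₚ.<⇒≤ p<m) m≤q))) (from m≤q)
... | no  p≮m = d (from k≤p) (from (ℕₚ.≮⇒≥ p≮m))

-- The rank of `below k` is 0 whatever `k` is; that `k` does not exceed `m` comes from disjointness.
-- Final segments have too large a rank.
lower-rank⇒⊆below : {σ : Side n} {m : Fin n} →
  Disjoint σ (only m) → rank σ ℕ.< rank (only m) → σ ⊆ below m
lower-rank⇒⊆below {σ = only k} d (s≤s k<m) only = below k<m
lower-rank⇒⊆below {σ = below k} d _ (below q<k) =
  below (ℕₚ.<-≤-trans q<k (∌below⇒≥ λ b → d b only))
lower-rank⇒⊆below {σ = from k} {m} d (s≤s n<m) _ = contradiction n<m (ℕₚ.<⇒≯ (toℕ<n m))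

higher-rank⇒⊆from : {σ : Side n} {m : Fin n} →
  Disjoint σ (only m) → rank (only m) ℕ.< rank σ → σ ⊆ from m
higher-rank⇒⊆from {σ = only k} d (s≤s m<k) only = from (ℕₚ.<⇒≤ m<k)
higher-rank⇒⊆from {σ = from k} d _ (from k≤q) =
  from (ℕₚ.≤-trans (ℕₚ.<⇒≤ (∌from⇒< λ b → d b only)) k≤q)

rank≤ : (σ : Side n) → rank σ ℕ.≤ suc n
rank≤ (only k)  = s≤s (ℕₚ.<⇒≤ (toℕ<n k))
rank≤ (below k) = z≤n
rank≤ (from k)  = ℕₚ.≤-refl

-- The third of four disjoint sides is a single key: only the first can be an
-- initial segment, and only the last a final one.
cut-before-third : {σ τ υ φ : Side n} →
  Disjoint σ υ → Disjoint τ υ → Disjoint υ φ →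
  rank σ ℕ.< rank υ → rank τ ℕ.< rank υ → rank υ ℕ.< rank φ →
  ∃[ m ] (σ ⊆ below m × τ ⊆ below m) × (υ ⊆ from m × φ ⊆ from m)
cut-before-third {υ = only m} d₁ d₂ d₃ l₁ l₂ l₃ =
  m , (lower-rank⇒⊆below d₁ l₁ , lower-rank⇒⊆below d₂ l₂) ,
      ((λ { only → from ℕₚ.≤-refl }) , higher-rank⇒⊆from (disjoint-sym d₃) l₃)
cut-before-third {υ = from m} {φ} _ _ _ _ _ l₃ =
  contradiction l₃ (ℕₚ.≤⇒≯ (rank≤ φ))

-- Pairing a fourth side with one of three others

record Isolates (x σ τ υ : Side n) : Set where
  constructor isolates
  field
    inner  : σ ⊆ x
    outer₁ : Disjoint τ x
    outer₂ : Disjoint υ x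

isolates-comm : {x σ τ υ : Side n} → Isolates x σ τ υ → Isolates x σ υ τ
isolates-comm (isolates i o₁ o₂) = isolates i o₂ o₁

IsolatesOne : (x σ₀ σ₁ σ₂ : Side n) → Set
IsolatesOne x σ₀ σ₁ σ₂ =
  Isolates x σ₀ σ₁ σ₂ ⊎ Isolates x σ₁ σ₀ σ₂ ⊎ Isolates x σ₂ σ₀ σ₁

module FourSides {n : ℕ} (φ : Side n) (φ≠∅ : Nonempty φ) where

  record Ok (σ : Side n) : Set where
    constructor _,_
    field
      nonempty : Nonempty σ
      disjoint : Disjoint σ φ

  compare : {σ τ : Side n} → Disjoint σ τ → Nonempty σ → Nonempty τ →
    rank σ ℕ.< rank τ ⊎ rank τ ℕ.< rank σ
  compare d ne ne′ with ℕₚ.≤-total (rank _) (rank _)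
  ... | inj₁ le = inj₁ (ℕₚ.≤∧≢⇒< le (rank-injective d ne ne′))
  ... | inj₂ ge = inj₂ (ℕₚ.≤∧≢⇒< ge (rank-injective d ne ne′ ∘ ≡.sym))

  -- The case split finds the third of the four sides: `τ`, `φ` or `υ`. The cut before it leaves `φ`
  -- together with `σ` or `υ`, never with the middle side `τ`, and `x` is the half that holds `φ`.
  pair-sorted : {σ τ υ : Side n} → Ok σ → Ok τ → Ok υ →
    Disjoint σ τ → Disjoint σ υ → Disjoint τ υ →
    rank σ ℕ.< rank τ → rank τ ℕ.< rank υ →
    ∃[ x ] φ ⊆ x × (Isolates x σ τ υ ⊎ Isolates x υ σ τ)
  pair-sorted (_ , dσ) (neτ , dτ) (neυ , dυ) dστ dσυ dτυ σ<τ τ<υ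
    with compare dτ neτ φ≠∅ | compare dυ neυ φ≠∅
  ... | inj₂ φ<τ | _ =
    let m , (σ⊆ , φ⊆) , (τ⊆ , υ⊆) = cut-before-third dστ (disjoint-sym dτ) dτυ σ<τ φ<τ τ<υ
    in below m , φ⊆ , inj₁ (isolates σ⊆ (from⇒∌below ∘ τ⊆) (from⇒∌below ∘ υ⊆))
  ... | inj₁ τ<φ | inj₂ φ<υ =
    let m , (σ⊆ , τ⊆) , (φ⊆ , υ⊆) =
          cut-before-third dσ dτ (disjoint-sym dυ) (ℕₚ.<-trans σ<τ τ<φ) τ<φ φ<υ
    in from m , φ⊆ , inj₂ (isolates υ⊆ (below⇒∌from ∘ σ⊆) (below⇒∌from ∘ τ⊆))
  ... | inj₁ _ | inj₁ υ<φ =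
    let m , (σ⊆ , τ⊆) , (υ⊆ , φ⊆) =
          cut-before-third dσυ dτυ dυ (ℕₚ.<-trans σ<τ τ<υ) τ<υ υ<φ
    in from m , φ⊆ , inj₂ (isolates υ⊆ (below⇒∌from ∘ σ⊆) (below⇒∌from ∘ τ⊆))

  pair : {σ₀ σ₁ σ₂ : Side n} → Ok σ₀ → Ok σ₁ → Ok σ₂ →
    Disjoint σ₀ σ₁ → Disjoint σ₀ σ₂ → Disjoint σ₁ σ₂ →
    ∃[ x ] φ ⊆ x × IsolatesOne x σ₀ σ₁ σ₂
  pair {σ₀} {σ₁} {σ₂} o₀@(ne₀ , _) o₁@(ne₁ , _) o₂@(ne₂ , _) d₀₁ d₀₂ d₁₂
    with compare d₀₁ ne₀ ne₁ | compare d₀₂ ne₀ ne₂ | compare d₁₂ ne₁ ne₂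
  ... | inj₁ 0<1 | _        | inj₁ 1<2 =
    let x , φ⊆x , i = pair-sorted o₀ o₁ o₂ d₀₁ d₀₂ d₁₂ 0<1 1<2
    in x , φ⊆x , [ inj₁ , inj₂ ∘ inj₂ ]′ i
  ... | _        | inj₁ 0<2 | inj₂ 2<1 =
    let x , φ⊆x , i = pair-sorted o₀ o₂ o₁ d₀₂ d₀₁ (disjoint-sym d₁₂) 0<2 2<1
    in x , φ⊆x , [ inj₁ ∘ isolates-comm , inj₂ ∘ inj₁ ]′ i
  ... | inj₂ 1<0 | inj₁ 0<2 | _        =
    let x , φ⊆x , i = pair-sorted o₁ o₀ o₂ (disjoint-sym d₀₁) d₁₂ d₀₂ 1<0 0<2
    in x , φ⊆x , [ inj₂ ∘ inj₁ , inj₂ ∘ inj₂ ∘ isolates-comm ]′ i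
  ... | _        | inj₂ 2<0 | inj₁ 1<2 =
    let x , φ⊆x , i = pair-sorted o₁ o₂ o₀ d₁₂ (disjoint-sym d₀₁) (disjoint-sym d₀₂) 1<2 2<0
    in x , φ⊆x , [ inj₂ ∘ inj₁ ∘ isolates-comm , inj₁ ]′ i
  ... | inj₁ 0<1 | inj₂ 2<0 | _        =
    let x , φ⊆x , i = pair-sorted o₂ o₀ o₁ (disjoint-sym d₀₂) (disjoint-sym d₁₂) d₀₁ 2<0 0<1
    in x , φ⊆x , [ inj₂ ∘ inj₂ , inj₂ ∘ inj₁ ∘ isolates-comm ]′ i
  ... | inj₂ 1<0 | inj₂ _   | inj₂ 2<1 =
    let x , φ⊆x , i = pair-sorted o₂ o₁ o₀ (disjoint-sym d₁₂) (disjoint-sym d₀₂) (disjoint-sym d₀₁) 2<1 1<0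
    in x , φ⊆x , [ inj₂ ∘ inj₂ ∘ isolates-comm , inj₁ ∘ isolates-comm ]′ i

-- Branching on a side, and search paths

-- `S` receives the keys of the side, whichever answer leads there. A less-than test is thus a
-- branch in two ways, over `below k` and over `from k`, so that one argument serves both choices of
-- the side branch.
branch : Side n → Tree n → Tree n → Tree n
branch (only k)  S M = node (equalTo k) S M
branch (below k) S M = node (lessThan k) S M
branch (from k)  S M = node (lessThan k) M S

-- The search for `q` in `T` arrives at `U` after `d` tests. Only the result and the depth are
-- recorded: these are what the comparison of two trees requires.
record Path (q : Fin n) (T : Tree n) (d : ℕ) (U : Tree n) : Set where
  constructor path
  field
    search-≡ : search T q ≡ search U q
    depth-≡  : depth T q ≡ d ℕ.+ depth U q

stay : {q : Fin n} {T : Tree n} → Path q T 0 T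
stay = path refl refl

answer-yes : {t : Test n} {q : Fin n} {l r U : Tree n} {d : ℕ} →
  answer t q ≡ true → Path q l d U → Path q (node t l r) (suc d) U
answer-yes {q = q} {l} {r} eq (path s e) = path
  (≡.trans (cong (λ b → if b then search l q else search r q) eq) s)
  (cong suc (≡.trans (cong (λ b → if b then depth l q else depth r q) eq) e))

answer-no : {t : Test n} {q : Fin n} {l r U : Tree n} {d : ℕ} →
  answer t q ≡ false → Path q r d U → Path q (node t l r) (suc d) U
answer-no {q = q} {l} {r} eq (path s e) = path
  (≡.trans (cong (λ b → if b then search l q else search r q) eq) s)
  (cong suc (≡.trans (cong (λ b → if b then depth l q else depth r q) eq) e))

inside : {σ : Side n} {q : Fin n} {S M U : Tree n} {d : ℕ} →
  σ ∋ q → Path q S d U → Path q (branch σ S M) (suc d) U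
inside {σ = only k}      only        = answer-yes (dec-true (k ≟ k) refl)
inside {σ = below k} {q} (below q<k) = answer-yes (dec-true (q <? k) q<k)
inside {σ = from k} {q}  (from k≤q)  = answer-no (dec-false (q <? k) (ℕₚ.≤⇒≯ k≤q))

outside : {σ : Side n} {q : Fin n} {S M U : Tree n} {d : ℕ} →
  ¬ σ ∋ q → Path q M d U → Path q (branch σ S M) (suc d) U
outside {σ = only k} {q}  ∌ = answer-no (dec-false (q ≟ k) λ { refl → ∌ only })
outside {σ = below k} {q} ∌ = answer-no (dec-false (q <? k) (∌ ∘ below))
outside {σ = from k} {q}  ∌ = answer-yes (dec-true (q <? k) (∌from⇒< ∌))

-- Leaf counts and the subtrees of a 2WCST

multiplicity : Tree n → Fin n → ℕ
multiplicity (leaf k)     q = if does (q ≟ k) then 1 else 0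
multiplicity (node t l r) q = multiplicity l q ℕ.+ multiplicity r q

multiplicity-leaf : (k : Fin n) → multiplicity (leaf k) k ≡ 1
multiplicity-leaf k rewrite dec-true (k ≟ k) refl = refl

multiplicity-leaf⁻¹ : {k q : Fin n} → multiplicity (leaf k) q ≡ 1 → q ≡ k
multiplicity-leaf⁻¹ {k = k} {q} eq with q ≟ k
... | yes q≡k = q≡k

multiplicity-branch : (σ : Side n) (S M : Tree n) (q : Fin n) →
  multiplicity (branch σ S M) q ≡ multiplicity S q ℕ.+ multiplicity M q
multiplicity-branch (only k)  S M q = refl
multiplicity-branch (below k) S M q = refl
multiplicity-branch (from k)  S M q = ℕₚ.+-comm (multiplicity M q) (multiplicity S q)

multiplicity-search : (T : Tree n) (q : Fin n) → 1 ℕ.≤ multiplicity T (search T q)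
multiplicity-search (leaf k) q = ℕₚ.≤-reflexive (≡.sym (multiplicity-leaf k))
multiplicity-search (node t l r) q with answer t q
... | true  = ℕₚ.m≤n⇒m≤n+o _ (multiplicity-search l q)
... | false = ℕₚ.m≤n⇒m≤o+n (multiplicity l _) (multiplicity-search r q)

-- The part of being a 2WCST that subtrees inherit: `Is2WCST` speaks of all keys, whereas a subtree
-- contains only some of them, each once and where the search finds it.
record Proper (T : Tree n) : Set where
  constructor proper
  field
    status : ∀ q → multiplicity T q ≡ 0 ⊎ (multiplicity T q ≡ 1 × search T q ≡ q)

open Proper

search⇒multiplicity : (T : Tree n) {q : Fin n} → search T q ≡ q → 1 ℕ.≤ multiplicity T q
search⇒multiplicity T {q} eq =
  subst (λ k → 1 ℕ.≤ multiplicity T k) eq (multiplicity-search T q)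

data Located (σ : Side n) (S M : Tree n) (q : Fin n) : Set where
  at-side : σ ∋ q → multiplicity S q ≡ 1 → search S q ≡ q → multiplicity M q ≡ 0 →
            Located σ S M q
  at-main : ¬ σ ∋ q → multiplicity S q ≡ 0 → multiplicity M q ≡ 1 → search M q ≡ q →
            Located σ S M q

summands-of-1 : ∀ {a b} → a ℕ.+ b ≡ 1 → 1 ℕ.≤ a → a ≡ 1 × b ≡ 0
summands-of-1 {suc zero}    {zero}  eq _ = refl , refl
summands-of-1 {suc zero}    {suc b} () _
summands-of-1 {suc (suc a)} {b}     () _

0≢1 : ∀ {m} → m ≡ 0 → ¬ m ≡ 1
0≢1 refl ()

module AtBranch {n : ℕ} (σ : Side n) (S M : Tree n) (p : Proper (branch σ S M)) where

  -- The search ends at a leaf `q` in the subtree that the test selects, so that subtree accounts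
  -- for the single occurrence and the other has none.
  locate : ∀ {q} → multiplicity (branch σ S M) q ≡ 1 → Located σ S M q
  locate {q} eq with status p q
  ... | inj₁ eq₀ = contradiction eq (0≢1 eq₀)
  ... | inj₂ (_ , found) with σ ∋? q
  ...   | yes σ∋q =
    let s≡q = ≡.trans (≡.sym (Path.search-≡ (inside {M = M} σ∋q (stay {T = S})))) found
        mS , mM = summands-of-1 (≡.trans (≡.sym (multiplicity-branch σ S M q)) eq)
                                (search⇒multiplicity S s≡q)
    in at-side σ∋q mS s≡q mM
  ...   | no  σ∌q =
    let s≡q = ≡.trans (≡.sym (Path.search-≡ (outside {S = S} σ∌q (stay {T = M})))) found
        mM , mS = summands-of-1
          (≡.trans (ℕₚ.+-comm (multiplicity M q) _)
                   (≡.trans (≡.sym (multiplicity-branch σ S M q)) eq))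
          (search⇒multiplicity M s≡q)
    in at-main σ∌q mS mM s≡q

  absent : ∀ {q} → multiplicity (branch σ S M) q ≡ 0 →
    multiplicity S q ≡ 0 × multiplicity M q ≡ 0
  absent {q} eq =
    let eq′ = ≡.trans (≡.sym (multiplicity-branch σ S M q)) eq
    in ℕₚ.m+n≡0⇒m≡0 _ eq′ , ℕₚ.m+n≡0⇒n≡0 (multiplicity S q) eq′

  proper-side : Proper S
  status proper-side q with status p q
  ... | inj₁ eq = inj₁ (proj₁ (absent eq))
  ... | inj₂ (eq , _) with locate eq
  ...   | at-side _ mS s≡q _ = inj₂ (mS , s≡q)
  ...   | at-main _ mS _ _   = inj₁ mS

  proper-main : Proper M
  status proper-main q with status p q
  ... | inj₁ eq = inj₁ (proj₂ (absent eq))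
  ... | inj₂ (eq , _) with locate eq
  ...   | at-side _ _ _ mM   = inj₁ mM
  ...   | at-main _ _ mM s≡q = inj₂ (mM , s≡q)

  side⇒∋ : ∀ {q} → multiplicity S q ≡ 1 → σ ∋ q
  side⇒∋ {q} mS with status p q
  ... | inj₁ eq = contradiction mS (0≢1 (proj₁ (absent eq)))
  ... | inj₂ (eq , _) with locate eq
  ...   | at-side σ∋q _ _ _ = σ∋q
  ...   | at-main _ mS₀ _ _ = contradiction mS (0≢1 mS₀)

  main⇒ : ∀ {q} → multiplicity M q ≡ 1 → multiplicity (branch σ S M) q ≡ 1
  main⇒ {q} mM with status p q
  ... | inj₁ eq = contradiction mM (0≢1 (proj₂ (absent eq)))
  ... | inj₂ (eq , _) = eq

  side⇒ : ∀ {q} → multiplicity S q ≡ 1 → multiplicity (branch σ S M) q ≡ 1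
  side⇒ {q} mS with status p q
  ... | inj₁ eq = contradiction mS (0≢1 (proj₁ (absent eq)))
  ... | inj₂ (eq , _) = eq

  main⇒∌ : ∀ {q} → multiplicity M q ≡ 1 → ¬ σ ∋ q
  main⇒∌ mM with locate (main⇒ mM)
  ... | at-side _ _ _ mM₀ = contradiction mM (0≢1 mM₀)
  ... | at-main σ∌q _ _ _ = σ∌q

some-leaf : (T : Tree n) → ∃[ q ] 1 ℕ.≤ multiplicity T q
some-leaf (leaf k) = k , ℕₚ.≤-reflexive (≡.sym (multiplicity-leaf k))
some-leaf (node t l r) with some-leaf l
... | q , 1≤ = q , ℕₚ.m≤n⇒m≤n+o _ 1≤

some-key : {T : Tree n} → Proper T → ∃[ q ] multiplicity T q ≡ 1
some-key {T = T} p with some-leaf T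
... | q , 1≤ with status p q
...   | inj₁ eq       = contradiction (subst (1 ℕ.≤_) eq 1≤) λ ()
...   | inj₂ (eq , _) = q , eq

-- Pruning unreachable parts

filter-++-∁ : {A : Set} {P : A → Set} (P? : Decidable P) (xs : List A) →
  xs ↭ filter P? xs ++ filter (∁? P?) xs
filter-++-∁ P? [] = ↭-refl
filter-++-∁ P? (x ∷ xs) with does (P? x)
... | true  = ↭-prep x (filter-++-∁ P? xs)
... | false = ↭-trans (↭-prep x (filter-++-∁ P? xs)) (↭-sym (shift x _ _))

Pruned : Tree n → List (Fin n) → Set
Pruned T P = ∃[ T′ ] leaves T′ ↭ P ×
  (∀ {q} → q ∈ P → search T′ q ≡ q × depth T′ q ℕ.≤ depth T q)

-- `P` lists the keys whose searches are to be kept; the root test splits it between the children. A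
-- test that sends no key of `P` to one child is replaced by the pruned other child, which only
-- shortens paths. A tree has at least one leaf, hence the separate outcome for empty `P`.
prune : (T : Tree n) (P : List (Fin n)) → Unique P → (∀ {q} → q ∈ P → search T q ≡ q) →
  P ≡ [] ⊎ Pruned T P
prune (leaf k) [] _ _ = inj₁ refl
prune (leaf k) (p ∷ []) _ correct with refl ← correct (here refl) =
  inj₂ (leaf k , ↭-refl , λ { (here refl) → refl , z≤n })
prune (leaf k) (p ∷ q ∷ P) ((p≢q ∷ _) ∷ _) correct =
  contradiction (≡.trans (≡.sym (correct (here refl))) (correct (there (here refl)))) p≢q
prune {n} (node t l r) P unique correct = combine
  (prune l Y (filter⁺ yes? unique) λ q∈Y →
    let q∈P , eq = ∈-filter⁻ yes? q∈Y
    in ≡.trans (≡.sym (Path.search-≡ (to-l l r eq))) (correct q∈P))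
  (prune r N (filter⁺ (∁? yes?) unique) λ q∈N →
    let q∈P , eq = ∈-filter⁻ (∁? yes?) q∈N
    in ≡.trans (≡.sym (Path.search-≡ (to-r l r eq))) (correct q∈P))
  where
  yes? : ∀ q → Dec (answer t q ≡ true)
  yes? q = answer t q Bool.≟ true

  Y N : List (Fin n)
  Y = filter yes? P
  N = filter (∁? yes?) P

  to-l : ∀ {q} l r → answer t q ≡ true → Path q (node t l r) 1 l
  to-l l r eq = answer-yes eq stay

  to-r : ∀ {q} l r → ¬ answer t q ≡ true → Path q (node t l r) 1 r
  to-r l r ≢true = answer-no (Bool.¬-not ≢true) stay

  P↭ : P ↭ Y ++ N
  P↭ = filter-++-∁ yes? P

  side-of : ∀ {q} → q ∈ P → q ∈ Y ⊎ q ∈ N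
  side-of q∈P = ∈-++⁻ Y (∈-resp-↭ P↭ q∈P)

  ∈[] : ∀ {Q} {q : Fin n} → Q ≡ [] → ¬ q ∈ Q
  ∈[] refl ()

  combine : Y ≡ [] ⊎ Pruned l Y → N ≡ [] ⊎ Pruned r N → P ≡ [] ⊎ Pruned (node t l r) P
  combine (inj₁ Y≡[]) (inj₁ N≡[]) =
    inj₁ (↭-empty-inv (subst (P ↭_) (cong₂ _++_ Y≡[] N≡[]) P↭))
  combine (inj₁ Y≡[]) (inj₂ (r′ , r′↭N , ok)) =
    inj₂ (r′ , ↭-trans (subst (λ Q → leaves r′ ↭ Q ++ N) (≡.sym Y≡[]) r′↭N) (↭-sym P↭) ,
          λ q∈P → [ (λ q∈Y → contradiction q∈Y (∈[] Y≡[])) , found ]′ (side-of q∈P))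
    where
    found : ∀ {q} → q ∈ N → search r′ q ≡ q × depth r′ q ℕ.≤ depth (node t l r) q
    found q∈N = let s , d = ok q∈N in
      s , ℕₚ.≤-trans (ℕₚ.m≤n⇒m≤1+n d)
            (ℕₚ.≤-reflexive (≡.sym (Path.depth-≡ (to-r l r (proj₂ (∈-filter⁻ (∁? yes?) {xs = P} q∈N))))))
  combine (inj₂ (l′ , l′↭Y , ok)) (inj₁ N≡[]) =
    inj₂ (l′ , ↭-trans l′↭Y (↭-trans (↭-reflexive Y≡Y++N) (↭-sym P↭)) ,
          λ q∈P → [ found , (λ q∈N → contradiction q∈N (∈[] N≡[])) ]′ (side-of q∈P))
    where
    Y≡Y++N : Y ≡ Y ++ N
    Y≡Y++N = ≡.trans (≡.sym (++-identityʳ Y)) (cong (Y ++_) (≡.sym N≡[]))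

    found : ∀ {q} → q ∈ Y → search l′ q ≡ q × depth l′ q ℕ.≤ depth (node t l r) q
    found q∈Y = let s , d = ok q∈Y in
      s , ℕₚ.≤-trans (ℕₚ.m≤n⇒m≤1+n d)
            (ℕₚ.≤-reflexive (≡.sym (Path.depth-≡ (to-l l r (proj₂ (∈-filter⁻ yes? {xs = P} q∈Y))))))
  combine (inj₂ (l′ , l′↭Y , ok₁)) (inj₂ (r′ , r′↭N , ok₂)) =
    inj₂ (node t l′ r′ , ↭-trans (++⁺ l′↭Y r′↭N) (↭-sym P↭) ,
          λ q∈P → [ found₁ , found₂ ]′ (side-of q∈P))
    where
    Found : Fin n → Set
    Found q = search (node t l′ r′) q ≡ q × depth (node t l′ r′) q ℕ.≤ depth (node t l r) q

    found₁ : ∀ {q} → q ∈ Y → Found q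
    found₁ q∈Y =
      let s , d = ok₁ q∈Y
          _ , eq = ∈-filter⁻ yes? {xs = P} q∈Y
          path s′ d′ = to-l l′ r′ eq
      in ≡.trans s′ s ,
         ≡.subst₂ ℕ._≤_ (≡.sym d′) (≡.sym (Path.depth-≡ (to-l l r eq))) (s≤s d)

    found₂ : ∀ {q} → q ∈ N → Found q
    found₂ q∈N =
      let s , d = ok₂ q∈N
          _ , eq = ∈-filter⁻ (∁? yes?) {xs = P} q∈N
          path s′ d′ = to-r l′ r′ eq
      in ≡.trans s′ s ,
         ≡.subst₂ ℕ._≤_ (≡.sym d′) (≡.sym (Path.depth-≡ (to-r l r eq))) (s≤s d)

-- The given key shows that the list of all keys is nonempty, so that pruning leaves a tree.
prune-all : Fin n → (T : Tree n) → (∀ q → search T q ≡ q) →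
  ∃[ T′ ] Is2WCST T′ × (∀ q → depth T′ q ℕ.≤ depth T q)
prune-all {n} k T correct with prune T (allFin n) (allFin⁺ n) (λ {q} _ → correct q)
... | inj₁ eq = contradiction (subst (k ∈_) eq (∈-allFin k)) λ ()
... | inj₂ (T′ , perm , ok) =
  T′ , (perm , λ q → proj₁ (ok (∈-allFin q))) , λ q → proj₂ (ok (∈-allFin q))

-- Every key labels exactly one leaf of a 2WCST

occurrences : Fin n → List (Fin n) → ℕ
occurrences q []       = 0
occurrences q (k ∷ ks) = (if does (q ≟ k) then 1 else 0) ℕ.+ occurrences q ks

occurrences-++ : (q : Fin n) (ks ls : List (Fin n)) →
  occurrences q (ks ++ ls) ≡ occurrences q ks ℕ.+ occurrences q ls
occurrences-++ q []       ls = refl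
occurrences-++ q (k ∷ ks) ls =
  ≡.trans (cong (b ℕ.+_) (occurrences-++ q ks ls)) (≡.sym (ℕₚ.+-assoc b _ _))
  where
  b : ℕ
  b = if does (q ≟ k) then 1 else 0

occurrences-↭ : (q : Fin n) {ks ls : List (Fin n)} → ks ↭ ls → occurrences q ks ≡ occurrences q ls
occurrences-↭ q refl          = refl
occurrences-↭ q (prep k p)    = cong (_ ℕ.+_) (occurrences-↭ q p)
occurrences-↭ q (swap k l p)  = ≡.trans
  (cong (λ o → (if does (q ≟ k) then 1 else 0) ℕ.+ ((if does (q ≟ l) then 1 else 0) ℕ.+ o))
        (occurrences-↭ q p))
  (x∙yz≈y∙xz ℕₚ.+-commutativeSemigroup (if does (q ≟ k) then 1 else 0) (if does (q ≟ l) then 1 else 0) _)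
occurrences-↭ q (trans p₁ p₂) = ≡.trans (occurrences-↭ q p₁) (occurrences-↭ q p₂)

occurrences-∉ : {q : Fin n} {ks : List (Fin n)} → All (q ≢_) ks → occurrences q ks ≡ 0
occurrences-∉ [] = refl
occurrences-∉ {q = q} {k ∷ _} (q≢k ∷ q∉ks) rewrite dec-false (q ≟ k) q≢k = occurrences-∉ q∉ks

occurrences-unique : {q : Fin n} {ks : List (Fin n)} → Unique ks → q ∈ ks → occurrences q ks ≡ 1
occurrences-unique {q = q} (q∉ks ∷ _) (here refl)
  rewrite dec-true (q ≟ q) refl = cong suc (occurrences-∉ q∉ks)
occurrences-unique {q = q} {k ∷ _} (k∉ks ∷ u) (there q∈ks)
  rewrite dec-false (q ≟ k) (λ { refl → All.lookup k∉ks q∈ks refl }) = occurrences-unique u q∈ks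

occurrences-leaves : (T : Tree n) (q : Fin n) → occurrences q (leaves T) ≡ multiplicity T q
occurrences-leaves (leaf k)     q = ℕₚ.+-identityʳ _
occurrences-leaves (node t l r) q = ≡.trans (occurrences-++ q (leaves l) (leaves r))
  (cong₂ ℕ._+_ (occurrences-leaves l q) (occurrences-leaves r q))

2WCST-multiplicity : {T : Tree n} → Is2WCST T → ∀ q → multiplicity T q ≡ 1
2WCST-multiplicity {n} {T} (perm , _) q =
  ≡.trans (≡.sym (occurrences-leaves T q))
    (≡.trans (occurrences-↭ q perm) (occurrences-unique (allFin⁺ n) (∈-allFin q)))

2WCST-proper : {T : Tree n} → Is2WCST T → Proper T
status (2WCST-proper {T = T} is) q = inj₂ (2WCST-multiplicity {T = T} is q , proj₂ is q)

-- Weighted sums over the keys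

module Rearrangement {c ℓ₁ ℓ₂ : Level} (F : OrderedField c ℓ₁ ℓ₂) {n : ℕ}
  (w : Fin n → OrderedField.Carrier F)
  (w≥0 : ∀ k → OrderedField._≤_ F (OrderedField.0# F) (w k)) where

  private
    module F = OrderedField F
  open OrderedField F using (Carrier; _≈_; _≤_; _+_; _*_; -_; 0#; 1#; ½; _⊓_; _·_; sum)
  open Weighted F w
  open DecTotalOrder F.decTotalOrder using (poset; total; antisym)
    renaming (refl to ≤-refl; trans to ≤-trans; reflexive to ≤-reflexive)
  open ≤-Reasoning poset
  open import Algebra.Construct.NaturalChoice.Min F.totalOrder using (⊓-glb)
  open import Algebra.Properties.Ring F.ring using (-1*x≈-x; -‿involutive)
  open import Algebra.Properties.AbelianGroup F.+-abelianGroup using (xyx⁻¹≈y)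
  open import Algebra.Properties.CommutativeMonoid.Sum F.+-commutativeMonoid
    using (sum-cong-≋; sum-replicate-zero; ∑-distrib-+)
  open import Algebra.Properties.Monoid.Mult F.+-monoid using (×-homo-+)

  +-mono-≤ : ∀ {a b c d} → a ≤ b → c ≤ d → a + c ≤ b + d
  +-mono-≤ {a} {b} {c} {d} a≤b c≤d = begin
    a + c ≤⟨ F.+-monoˡ-≤ c a≤b ⟩
    b + c ≈⟨ F.+-comm b c ⟩
    c + b ≤⟨ F.+-monoˡ-≤ b c≤d ⟩
    d + b ≈⟨ F.+-comm d b ⟩
    b + d ∎

  +-cancelˡ-≤ : ∀ a {b c} → a + b ≤ a + c → b ≤ c
  +-cancelˡ-≤ a {b} {c} le = begin
    b               ≈⟨ lemma b ⟨
    (a + b) + - a   ≤⟨ F.+-monoˡ-≤ (- a) le ⟩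
    (a + c) + - a   ≈⟨ lemma c ⟩
    c               ∎
    where
    lemma : ∀ x → (a + x) + - a ≈ x
    lemma x = xyx⁻¹≈y a x

  ·-nonneg : ∀ m k → 0# ≤ m · w k
  ·-nonneg zero    k = ≤-refl
  ·-nonneg (suc m) k = ≤-trans (≤-reflexive (F.sym (F.+-identityʳ 0#)))
                               (+-mono-≤ (w≥0 k) (·-nonneg m k))

  ·-monoˡ-≤ : ∀ {l m} k → l ℕ.≤ m → l · w k ≤ m · w k
  ·-monoˡ-≤ {m = m} k z≤n = ·-nonneg m k
  ·-monoˡ-≤ k (s≤s l≤m) = +-mono-≤ ≤-refl (·-monoˡ-≤ k l≤m)

  sum-mono-≤ : ∀ {m} {f g : Fin m → Carrier} → (∀ i → f i ≤ g i) → sum f ≤ sum g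
  sum-mono-≤ {zero}  f≤g = ≤-refl
  sum-mono-≤ {suc m} f≤g = +-mono-≤ (f≤g zero) (sum-mono-≤ (f≤g ∘ suc))

  -- Cost and weight in one form: `cost T` is the mass of `depth T`, and `weight T` is that of
  -- `multiplicity T`.
  mass : (Fin n → ℕ) → Carrier
  mass f = sum λ k → f k · w k

  mass-mono-≤ : ∀ {f g} → (∀ k → f k ℕ.≤ g k) → mass f ≤ mass g
  mass-mono-≤ f≤g = sum-mono-≤ λ k → ·-monoˡ-≤ k (f≤g k)

  mass-+ : ∀ f g → mass (λ k → f k ℕ.+ g k) ≈ mass f + mass g
  mass-+ f g = F.trans (sum-cong-≋ λ k → ×-homo-+ (w k) (f k) (g k))
                       (∑-distrib-+ (λ k → f k · w k) (λ k → g k · w k))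

  -- General in `m` and `v`, because the induction on `k` passes to the tail of the sum.
  sum-indicator : ∀ {m} (v : Fin m → Carrier) k →
    sum (λ q → multiplicity (leaf k) q · v q) ≈ v k
  sum-indicator {suc m} v zero = F.trans
    (F.+-cong (F.+-identityʳ (v zero)) (sum-replicate-zero m)) (F.+-identityʳ (v zero))
  sum-indicator {suc m} v (suc k) = F.trans (F.+-identityˡ _) (sum-indicator (v ∘ suc) k)

  weight-mass : ∀ T → weight T ≈ mass (multiplicity T)
  weight-mass (leaf k)     = F.sym (sum-indicator w k)
  weight-mass (node t l r) = F.trans (F.+-cong (weight-mass l) (weight-mass r))
                                     (F.sym (mass-+ (multiplicity l) (multiplicity r)))

  weight-mono-≤ : ∀ S T → (∀ q → multiplicity S q ℕ.≤ multiplicity T q) → weight S ≤ weight T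
  weight-mono-≤ S T le = begin
    weight S                ≈⟨ weight-mass S ⟩
    mass (multiplicity S)   ≤⟨ mass-mono-≤ le ⟩
    mass (multiplicity T)   ≈⟨ weight-mass T ⟨
    weight T                ∎

  weight-branch : ∀ σ S M → weight (branch σ S M) ≈ weight S + weight M
  weight-branch (only k)  S M = F.refl
  weight-branch (below k) S M = F.refl
  weight-branch (from k)  S M = F.+-comm (weight M) (weight S)

  -- The exchange argument

  -- Both trees lead `q` to the same subtree, so the result is unchanged and the depths differ by
  -- `new` against `old`. These are numerals wherever an exchange is built, so `balance` is settled
  -- by evaluation.
  record Exchange (T T′ : Tree n) (gain loss : Fin n → ℕ) (q : Fin n) : Set where
    constructor exchange
    field
      {target}      : Tree n
      {old new}     : ℕ
      {gained lost} : ℕ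
      path-old      : Path q T old target
      path-new      : Path q T′ new target
      gain-≡        : gain q ≡ gained
      loss-≡        : loss q ≡ lost
      {balance}     : True (new ℕ.+ gained ≤? old ℕ.+ lost)

  -- Summing the balances with weights gives `cost T′ + mass gain ≤ cost T + mass loss`, and
  -- `cost T ≤ cost T′` by optimality. `T′` may have unreachable parts, since its pruned form is a
  -- 2WCST of no greater cost.
  optimal-exchange : ∀ {T} T′ gain loss → Optimal T → (∀ q → Exchange T T′ gain loss q) →
    mass gain ≤ mass loss
  optimal-exchange {T} T′ gain loss ((perm , correct) , minimal) ex =
    +-cancelˡ-≤ (mass (depth T)) (begin
      mass (depth T) + mass gain              ≤⟨ F.+-monoˡ-≤ _ cheaper ⟩
      mass (depth T′) + mass gain             ≈⟨ mass-+ (depth T′) gain ⟨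
      mass (λ q → depth T′ q ℕ.+ gain q)      ≤⟨ mass-mono-≤ pointwise ⟩
      mass (λ q → depth T q ℕ.+ loss q)       ≈⟨ mass-+ (depth T) loss ⟩
      mass (depth T) + mass loss              ∎)
    where
    correct′ : ∀ q → search T′ q ≡ q
    correct′ q = let open Exchange (ex q) in
      ≡.trans (Path.search-≡ path-new) (≡.trans (≡.sym (Path.search-≡ path-old)) (correct q))

    shift-depth : ∀ {a b d g l} → a ℕ.+ g ℕ.≤ b ℕ.+ l → (a ℕ.+ d) ℕ.+ g ℕ.≤ (b ℕ.+ d) ℕ.+ l
    shift-depth {a} {b} {d} {g} {l} le =
      ≡.subst₂ ℕ._≤_ (xy∙z≈xz∙y ℕₚ.+-commutativeSemigroup a g d)
                     (xy∙z≈xz∙y ℕₚ.+-commutativeSemigroup b l d) (ℕₚ.+-monoˡ-≤ d le)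

    pointwise : ∀ q → depth T′ q ℕ.+ gain q ℕ.≤ depth T q ℕ.+ loss q
    pointwise q with ex q
    ... | exchange {old = o} {m} (path _ d) (path _ d′) eg el {le}
      rewrite d | d′ | eg | el = shift-depth {m} {o} (toWitness le)

    cheaper : cost T ≤ cost T′
    cheaper =
      -- Any key will do here; it only witnesses that there is one.
      let T″ , is , shallower = prune-all (search T (proj₁ (some-leaf T))) T′ correct′
      in ≤-trans (minimal T″ is) (mass-mono-≤ shallower)

  -- Exchanges around the first two tests

  module Triple (σ₀ : Side n) (S₀ : Tree n) (σ₁ : Side n) (S₁ T₂ : Tree n)
    (optimal : Optimal (branch σ₀ S₀ (branch σ₁ S₁ T₂))) where

    T₁ T : Tree n
    T₁ = branch σ₁ S₁ T₂
    T  = branch σ₀ S₀ T₁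

    T-proper : Proper T
    T-proper = 2WCST-proper {T = T} (proj₁ optimal)

    module At₀ = AtBranch σ₀ S₀ T₁ T-proper
    module At₁ = AtBranch σ₁ S₁ T₂ At₀.proper-main

    data Region (q : Fin n) : Set where
      at₀ : σ₀ ∋ q →
            multiplicity S₀ q ≡ 1 → multiplicity S₁ q ≡ 0 → multiplicity T₂ q ≡ 0 → Region q
      at₁ : ¬ σ₀ ∋ q → σ₁ ∋ q →
            multiplicity S₀ q ≡ 0 → multiplicity S₁ q ≡ 1 → multiplicity T₂ q ≡ 0 → Region q
      at₂ : ¬ σ₀ ∋ q → ¬ σ₁ ∋ q →
            multiplicity S₀ q ≡ 0 → multiplicity S₁ q ≡ 0 → multiplicity T₂ q ≡ 1 → Region q

    region : ∀ q → Region q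
    region q with At₀.locate (2WCST-multiplicity {T = T} (proj₁ optimal) q)
    ... | at-side s m₀ _ m₁ =
      let eq = ≡.trans (≡.sym (multiplicity-branch σ₁ S₁ T₂ q)) m₁
      in at₀ s m₀ (ℕₚ.m+n≡0⇒m≡0 _ eq) (ℕₚ.m+n≡0⇒n≡0 (multiplicity S₁ q) eq)
    ... | at-main s m₀ m₁ _ with At₁.locate m₁
    ...   | at-side s′ m₁ _ m₂ = at₁ s s′ m₀ m₁ m₂
    ...   | at-main s′ m₁ m₂ _ = at₂ s s′ m₀ m₁ m₂

    key₁ : ∃[ q ] ¬ σ₀ ∋ q × σ₁ ∋ q
    key₁ = let q , m = some-key At₁.proper-side
           in q , At₀.main⇒∌ (At₁.side⇒ m) , At₁.side⇒∋ m

    key₂⇒ : ∀ {q} → multiplicity T₂ q ≡ 1 → ¬ σ₀ ∋ q × ¬ σ₁ ∋ q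
    key₂⇒ m = At₀.main⇒∌ (At₁.main⇒ m) , At₁.main⇒∌ m

    nonempty₀ : Nonempty σ₀
    nonempty₀ = let q , m = some-key At₀.proper-side in q , At₀.side⇒∋ m

    nonempty₁ : Nonempty σ₁
    nonempty₁ = let q , _ , σ₁∋q = key₁ in q , σ₁∋q

    sides : Fin n → ℕ
    sides q = multiplicity S₀ q ℕ.+ multiplicity S₁ q

    Light : Set ℓ₂
    Light = weight T₂ ≤ weight S₀ + weight S₁

    light : mass (multiplicity T₂) ≤ mass sides → Light
    light le = begin
      weight T₂                                       ≈⟨ weight-mass T₂ ⟩
      mass (multiplicity T₂)                          ≤⟨ le ⟩
      mass sides                                      ≈⟨ mass-+ (multiplicity S₀) (multiplicity S₁) ⟩
      mass (multiplicity S₀) + mass (multiplicity S₁) ≈⟨ F.+-cong (weight-mass S₀) (weight-mass S₁) ⟨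
      weight S₀ + weight S₁                           ∎

    -- The pattern of most comparisons: every key of `T₂` rises by at least one test, and keys of
    -- `S₀` and `S₁` sink by at most one.
    by-exchange : ∀ T′ → (∀ q → Exchange T T′ (multiplicity T₂) sides q) → Light
    by-exchange T′ ex = light (optimal-exchange T′ (multiplicity T₂) sides optimal ex)

    -- With `σ₁` asked first and `σ₀` asked only inside it, `T₂` rises by one test, `S₀` sinks by
    -- one and `S₁` keeps its depth.
    nested-light : σ₀ ⊆ σ₁ → Light
    nested-light σ₀⊆σ₁ = by-exchange T′ λ q → ex q (region q)
      where
      T′ : Tree n
      T′ = branch σ₁ (branch σ₀ S₀ S₁) T₂

      ex : ∀ q → Region q → Exchange T T′ (multiplicity T₂) sides q
      ex q (at₀ s m₀ m₁ m₂) =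
        exchange (inside s stay) (inside (σ₀⊆σ₁ s) (inside s stay)) m₂ (cong₂ ℕ._+_ m₀ m₁)
      ex q (at₁ s s′ m₀ m₁ m₂) =
        exchange (outside s (inside s′ stay)) (inside s′ (outside s stay)) m₂ (cong₂ ℕ._+_ m₀ m₁)
      ex q (at₂ s s′ m₀ m₁ m₂) =
        exchange (outside s (outside s′ stay)) (outside s′ stay) m₂ (cong₂ ℕ._+_ m₀ m₁)

    -- The only key of `T₂` is asked first, which pushes both side branches down by one test.
    leaf-light : ∀ {k} → T₂ ≡ leaf k → Light
    leaf-light {k} refl = by-exchange T′ λ q → ex q (region q)
      where
      T′ : Tree n
      T′ = branch (only k) (leaf k) (branch σ₀ S₀ S₁)

      absent : ∀ {q} → multiplicity (leaf k) q ≡ 0 → ¬ only k ∋ q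
      absent m only = 0≢1 m (multiplicity-leaf k)

      present : ∀ {q} → multiplicity (leaf k) q ≡ 1 → only k ∋ q
      present {q} m with refl ← multiplicity-leaf⁻¹ {k = k} {q} m = only

      ex : ∀ q → Region q → Exchange T T′ (multiplicity T₂) sides q
      ex q (at₀ s m₀ m₁ m₂) =
        exchange (inside s stay) (outside (absent m₂) (inside s stay)) m₂ (cong₂ ℕ._+_ m₀ m₁)
      ex q (at₁ s s′ m₀ m₁ m₂) =
        exchange (outside s (inside s′ stay)) (outside (absent m₂) (outside s stay))
                 m₂ (cong₂ ℕ._+_ m₀ m₁)
      ex q (at₂ s s′ m₀ m₁ m₂) =
        exchange (outside s (outside s′ stay)) (inside (present m₂) stay) m₂ (cong₂ ℕ._+_ m₀ m₁)

    -- When the root test of `T₂` separates `σ₀` from `σ₁`, it can come first; each half then needs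
    -- only one of the two other tests. Keys of `T₂` go from three tests to two, `S₀` sinks by one
    -- and `S₁` stays.
    split-light : ∀ {τ A B} → T₂ ≡ branch τ A B → σ₀ ⊆ τ → Disjoint σ₁ τ → Light
    split-light {τ} {A} {B} refl σ₀⊆τ σ₁∩τ=∅ = by-exchange T′ λ q → ex q (region q)
      where
      T′ : Tree n
      T′ = branch τ (branch σ₀ S₀ A) (branch σ₁ S₁ B)

      ex : ∀ q → Region q → Exchange T T′ (multiplicity T₂) sides q
      ex q (at₀ s m₀ m₁ m₂) =
        exchange (inside s stay) (inside (σ₀⊆τ s) (inside s stay)) m₂ (cong₂ ℕ._+_ m₀ m₁)
      ex q (at₁ s s′ m₀ m₁ m₂) =
        exchange (outside s (inside s′ stay)) (outside (σ₁∩τ=∅ s′) (inside s′ stay))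
                 m₂ (cong₂ ℕ._+_ m₀ m₁)
      ex q (at₂ s s′ m₀ m₁ m₂) with τ ∋? q
      ... | yes t = exchange (outside s (outside s′ (inside t stay))) (inside t (outside s stay))
                             m₂ (cong₂ ℕ._+_ m₀ m₁)
      ... | no  t = exchange (outside s (outside s′ (outside t stay))) (outside t (outside s′ stay))
                             m₂ (cong₂ ℕ._+_ m₀ m₁)

  -- Exchanges with three disjoint sides and a fourth

  module Quadruple (σ₀ : Side n) (S₀ : Tree n) (σ₁ : Side n) (S₁ : Tree n)
    (σ₂ : Side n) (S₂ T₃ : Tree n)
    (optimal : Optimal (branch σ₀ S₀ (branch σ₁ S₁ (branch σ₂ S₂ T₃))))
    (d₀₁ : Disjoint σ₀ σ₁) (d₀₂ : Disjoint σ₀ σ₂) (d₁₂ : Disjoint σ₁ σ₂) where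

    open Triple σ₀ S₀ σ₁ S₁ (branch σ₂ S₂ T₃) optimal

    module At₂ = AtBranch σ₂ S₂ T₃ At₁.proper-main

    T₂ : Tree n
    T₂ = branch σ₂ S₂ T₃

    -- The test x comes first.  Where it leaves a single σᵢ, that one test replaces
    -- three; elsewhere two of the σᵢ remain, and Y is T₃ without its root test.
    module Isolated (x : Side n) (Y : Tree n)
      (shed : ∀ {q} → multiplicity T₃ q ≡ 1 → ¬ x ∋ q → Path q T₃ 1 Y) where

      -- Outside `x`, `σ₂` precedes `σ₁`: the keys of `S₂` belong to `T₂` and must rise from three
      -- tests to two, while those of `S₁` may sink to three.
      isolated₀ : Isolates x σ₀ σ₁ σ₂ → Light
      isolated₀ (isolates i₀ o₁ o₂) = by-exchange T′ λ q → ex q (region q)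
        where
        T′ : Tree n
        T′ = branch x (branch σ₀ S₀ T₃) (branch σ₂ S₂ (branch σ₁ S₁ Y))

        ex : ∀ q → Region q → Exchange T T′ (multiplicity T₂) sides q
        ex q (at₀ s₀ m₀ m₁ m₂) =
          exchange (inside s₀ stay) (inside (i₀ s₀) (inside s₀ stay)) m₂ (cong₂ ℕ._+_ m₀ m₁)
        ex q (at₁ s₀ s₁ m₀ m₁ m₂) =
          exchange (outside s₀ (inside s₁ stay))
                   (outside (o₁ s₁) (outside (d₁₂ s₁) (inside s₁ stay)))
                   m₂ (cong₂ ℕ._+_ m₀ m₁)
        ex q (at₂ s₀ s₁ m₀ m₁ m₂) with At₂.locate m₂
        ... | at-side s₂ _ _ _ =
          exchange (outside s₀ (outside s₁ (inside s₂ stay))) (outside (o₂ s₂) (inside s₂ stay))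
                   m₂ (cong₂ ℕ._+_ m₀ m₁)
        ... | at-main s₂ _ m₃ _ with x ∋? q
        ...   | yes i = exchange (outside s₀ (outside s₁ (outside s₂ stay)))
                                 (inside i (outside s₀ stay))
                                 m₂ (cong₂ ℕ._+_ m₀ m₁)
        ...   | no  o = exchange (outside s₀ (outside s₁ (outside s₂ (shed m₃ o))))
                                 (outside o (outside s₂ (outside s₁ stay)))
                                 m₂ (cong₂ ℕ._+_ m₀ m₁)

      -- Outside `x`, `σ₀` keeps its place before `σ₁`, so that both side branches sink by just one
      -- test.
      isolated₂ : Isolates x σ₂ σ₀ σ₁ → Light
      isolated₂ (isolates i₂ o₀ o₁) = by-exchange T′ λ q → ex q (region q)
        where
        T′ : Tree n
        T′ = branch x (branch σ₂ S₂ T₃) (branch σ₀ S₀ (branch σ₁ S₁ Y))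

        ex : ∀ q → Region q → Exchange T T′ (multiplicity T₂) sides q
        ex q (at₀ s₀ m₀ m₁ m₂) =
          exchange (inside s₀ stay) (outside (o₀ s₀) (inside s₀ stay)) m₂ (cong₂ ℕ._+_ m₀ m₁)
        ex q (at₁ s₀ s₁ m₀ m₁ m₂) =
          exchange (outside s₀ (inside s₁ stay)) (outside (o₁ s₁) (outside s₀ (inside s₁ stay)))
                   m₂ (cong₂ ℕ._+_ m₀ m₁)
        ex q (at₂ s₀ s₁ m₀ m₁ m₂) with At₂.locate m₂
        ... | at-side s₂ _ _ _ =
          exchange (outside s₀ (outside s₁ (inside s₂ stay))) (inside (i₂ s₂) (inside s₂ stay))
                   m₂ (cong₂ ℕ._+_ m₀ m₁)
        ... | at-main s₂ _ m₃ _ with x ∋? q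
        ...   | yes i = exchange (outside s₀ (outside s₁ (outside s₂ stay)))
                                 (inside i (outside s₂ stay))
                                 m₂ (cong₂ ℕ._+_ m₀ m₁)
        ...   | no  o = exchange (outside s₀ (outside s₁ (outside s₂ (shed m₃ o))))
                                 (outside o (outside s₀ (outside s₁ stay)))
                                 m₂ (cong₂ ℕ._+_ m₀ m₁)

      -- `S₁` and `S₂` stay after two and three tests; `S₀` alone sinks, by one, and all of `T₃`
      -- rises by one.
      T₃≤S₀ : Isolates x σ₁ σ₀ σ₂ → mass (multiplicity T₃) ≤ mass (multiplicity S₀)
      T₃≤S₀ (isolates i₁ o₀ o₂) = optimal-exchange T′ _ _ optimal λ q → ex q (region q)
        where
        T′ : Tree n
        T′ = branch x (branch σ₁ S₁ T₃) (branch σ₀ S₀ (branch σ₂ S₂ Y))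

        ex : ∀ q → Region q → Exchange T T′ (multiplicity T₃) (multiplicity S₀) q
        ex q (at₀ s₀ m₀ m₁ m₂) =
          exchange (inside s₀ stay) (outside (o₀ s₀) (inside s₀ stay)) (proj₂ (At₂.absent m₂)) m₀
        ex q (at₁ s₀ s₁ m₀ m₁ m₂) =
          exchange (outside s₀ (inside s₁ stay)) (inside (i₁ s₁) (inside s₁ stay))
                   (proj₂ (At₂.absent m₂)) m₀
        ex q (at₂ s₀ s₁ m₀ m₁ m₂) with At₂.locate m₂
        ... | at-side s₂ _ _ m₃ =
          exchange (outside s₀ (outside s₁ (inside s₂ stay)))
                   (outside (o₂ s₂) (outside s₀ (inside s₂ stay))) m₃ m₀
        ... | at-main s₂ _ m₃ _ with x ∋? q
        ...   | yes i = exchange (outside s₀ (outside s₁ (outside s₂ stay)))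
                                 (inside i (outside s₁ stay)) m₃ m₀
        ...   | no  o = exchange (outside s₀ (outside s₁ (outside s₂ (shed m₃ o))))
                                 (outside o (outside s₀ (outside s₂ stay))) m₃ m₀

      -- The tests on the disjoint sides `σ₁` and `σ₂` can be swapped; this moves only `S₁` and
      -- `S₂`, by one test each.
      S₂≤S₁ : mass (multiplicity S₂) ≤ mass (multiplicity S₁)
      S₂≤S₁ = optimal-exchange T′ _ _ optimal λ q → ex q (region q)
        where
        T′ : Tree n
        T′ = branch σ₀ S₀ (branch σ₂ S₂ (branch σ₁ S₁ T₃))

        ex : ∀ q → Region q → Exchange T T′ (multiplicity S₂) (multiplicity S₁) q
        ex q (at₀ s₀ m₀ m₁ m₂) =
          exchange (inside s₀ stay) (inside s₀ stay) (proj₁ (At₂.absent m₂)) m₁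
        ex q (at₁ s₀ s₁ m₀ m₁ m₂) =
          exchange (outside s₀ (inside s₁ stay)) (outside s₀ (outside (d₁₂ s₁) (inside s₁ stay)))
                   (proj₁ (At₂.absent m₂)) m₁
        ex q (at₂ s₀ s₁ m₀ m₁ m₂) with At₂.locate m₂
        ... | at-side s₂ m₂′ _ m₃ =
          exchange (outside s₀ (outside s₁ (inside s₂ stay))) (outside s₀ (inside s₂ stay)) m₂′ m₁
        ... | at-main s₂ m₂′ m₃ _ =
          exchange (outside s₀ (outside s₁ (outside s₂ stay)))
                   (outside s₀ (outside s₂ (outside s₁ stay))) m₂′ m₁

      -- Unlike in the other two cases no single tree does: asking σ₂ before σ₀ would
      -- cost the keys of S₀ two comparisons.
      isolated₁ : Isolates x σ₁ σ₀ σ₂ → Light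
      isolated₁ i = light (begin
        mass (multiplicity T₂)
          ≈⟨ weight-mass T₂ ⟨
        weight T₂
          ≈⟨ weight-branch σ₂ S₂ T₃ ⟩
        weight S₂ + weight T₃
          ≈⟨ F.+-cong (weight-mass S₂) (weight-mass T₃) ⟩
        mass (multiplicity S₂) + mass (multiplicity T₃)
          ≤⟨ +-mono-≤ S₂≤S₁ (T₃≤S₀ i) ⟩
        mass (multiplicity S₁) + mass (multiplicity S₀)
          ≈⟨ F.+-comm _ _ ⟩
        mass (multiplicity S₀) + mass (multiplicity S₁)
          ≈⟨ mass-+ (multiplicity S₀) (multiplicity S₁) ⟨
        mass sides
          ∎)

      isolates-one⇒light : IsolatesOne x σ₀ σ₁ σ₂ → Light
      isolates-one⇒light = [ isolated₀ , [ isolated₁ , isolated₂ ]′ ]′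

    open Isolated using (isolates-one⇒light)

    nonempty₂ : Nonempty σ₂
    nonempty₂ = let q , m = some-key At₂.proper-side in q , At₂.side⇒∋ m

    -- `φ` is a side of the root test of `T₃`, or its single key. Keys outside `x` are outside `φ`
    -- as well, so for them the answer of that root test is known and `Y` suffices.
    fourth-side : (φ : Side n) (Y : Tree n) → Nonempty φ →
      Disjoint σ₀ φ → Disjoint σ₁ φ → Disjoint σ₂ φ →
      (∀ {q} → multiplicity T₃ q ≡ 1 → ¬ φ ∋ q → Path q T₃ 1 Y) → Light
    fourth-side φ Y φ≠∅ d₀ d₁ d₂ shed =
      let open FourSides φ φ≠∅
          x , φ⊆x , one = pair (nonempty₀ , d₀) (nonempty₁ , d₁) (nonempty₂ , d₂) d₀₁ d₀₂ d₁₂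
      in isolates-one⇒light x Y (λ m x∌q → shed m (x∌q ∘ φ⊆x)) one

    key₃⇒ : ∀ {q} → multiplicity T₃ q ≡ 1 → ¬ σ₀ ∋ q × ¬ σ₁ ∋ q × ¬ σ₂ ∋ q
    key₃⇒ m = let σ₀∌ , σ₁∌ = key₂⇒ (At₂.main⇒ m) in σ₀∌ , σ₁∌ , At₂.main⇒∌ m

    single-fourth-side : (k : Fin n) (Y : Tree n) → multiplicity T₃ k ≡ 1 →
      (∀ {q} → multiplicity T₃ q ≡ 1 → ¬ only k ∋ q → Path q T₃ 1 Y) → Light
    single-fourth-side k Y m =
      let σ₀∌ , σ₁∌ , σ₂∌ = key₃⇒ m
      in fourth-side (only k) Y (k , only)
           (∌⇒disjoint-only σ₀∌) (∌⇒disjoint-only σ₁∌) (∌⇒disjoint-only σ₂∌)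

    four-sides-light : Light
    four-sides-light = by-cases T₃ refl
      where
      by-cases : ∀ T → T₃ ≡ T → Light
      -- No key of `T₃` other than `k` exists, so the tree kept for such keys is arbitrary.
      by-cases (leaf k) refl = single-fourth-side k (leaf k) (multiplicity-leaf k) λ {q} m ∌ →
        contradiction (multiplicity-leaf⁻¹ {k = k} {q} m) λ { refl → ∌ only }
      by-cases (node (equalTo k) l r) refl =
        let module At₃ = AtBranch (only k) l r At₂.proper-main
            q , m = some-key At₃.proper-side
            k∈ = subst (λ k → multiplicity T₃ k ≡ 1) (only⁻¹ (At₃.side⇒∋ m)) (At₃.side⇒ m)
        in single-fourth-side k r k∈ λ _ ∌ → outside ∌ stay
      by-cases (node (lessThan k) l r) refl =
        cut (nested-or-disjoint σ₀ (below k) p∌₀ k∋p q∌₀ k∌q)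
            (nested-or-disjoint σ₁ (below k) p∌₁ k∋p q∌₁ k∌q)
            (nested-or-disjoint σ₂ (below k) p∌₂ k∋p q∌₂ k∌q)
        where
        module At₃ = AtBranch (below k) l r At₂.proper-main

        -- One key from each child of `T₃`. Neither lies in any `σᵢ`, so they serve as the witnesses
        -- for `nested-or-disjoint`.
        p q : Fin n
        p = proj₁ (some-key At₃.proper-side)
        q = proj₁ (some-key At₃.proper-main)

        k∋p : below k ∋ p
        k∋p = At₃.side⇒∋ (proj₂ (some-key At₃.proper-side))

        k∌q : ¬ below k ∋ q
        k∌q = At₃.main⇒∌ (proj₂ (some-key At₃.proper-main))

        p∌ : ¬ σ₀ ∋ p × ¬ σ₁ ∋ p × ¬ σ₂ ∋ p
        p∌ = key₃⇒ (At₃.side⇒ (proj₂ (some-key At₃.proper-side)))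

        q∌ : ¬ σ₀ ∋ q × ¬ σ₁ ∋ q × ¬ σ₂ ∋ q
        q∌ = key₃⇒ (At₃.main⇒ (proj₂ (some-key At₃.proper-main)))

        p∌₀ = proj₁ p∌
        p∌₁ = proj₁ (proj₂ p∌)
        p∌₂ = proj₂ (proj₂ p∌)
        q∌₀ = proj₁ q∌
        q∌₁ = proj₁ (proj₂ q∌)
        q∌₂ = proj₂ (proj₂ q∌)

        cut-below : IsolatesOne (below k) σ₀ σ₁ σ₂ → Light
        cut-below = isolates-one⇒light (below k) r λ _ ∌ → outside ∌ stay

        cut-from : IsolatesOne (from k) σ₀ σ₁ σ₂ → Light
        -- The root of `T₃` is read here as `branch (from k) r l`, whose main subtree is `l`.
        cut-from = isolates-one⇒light (from k) l λ _ ∌ → outside {σ = from k} ∌ stay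

        avoid : ∀ {σ} → σ ⊆ below k → Disjoint σ (from k)
        avoid σ⊆ = below⇒∌from ∘ σ⊆

        inner : ∀ {σ} → Disjoint σ (below k) → σ ⊆ from k
        inner d = ∌below⇒from ∘ d

        -- If all three sides lie on one side of the test, its other side is the fourth. Otherwise
        -- the test already isolates the odd one out and itself serves as `x`.
        cut : σ₀ ⊆ below k ⊎ Disjoint σ₀ (below k) → σ₁ ⊆ below k ⊎ Disjoint σ₁ (below k) →
              σ₂ ⊆ below k ⊎ Disjoint σ₂ (below k) → Light
        cut (inj₁ i₀) (inj₁ i₁) (inj₁ i₂) =
          fourth-side (from k) l (q , ∌below⇒from k∌q) (avoid i₀) (avoid i₁) (avoid i₂)
            λ _ ∌ → outside {σ = from k} ∌ stay
        cut (inj₂ o₀) (inj₂ o₁) (inj₂ o₂) =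
          fourth-side (below k) r (p , k∋p) o₀ o₁ o₂ λ _ ∌ → outside ∌ stay
        cut (inj₁ i₀) (inj₂ o₁) (inj₂ o₂) = cut-below (inj₁ (isolates i₀ o₁ o₂))
        cut (inj₂ o₀) (inj₁ i₁) (inj₂ o₂) = cut-below (inj₂ (inj₁ (isolates i₁ o₀ o₂)))
        cut (inj₂ o₀) (inj₂ o₁) (inj₁ i₂) = cut-below (inj₂ (inj₂ (isolates i₂ o₀ o₁)))
        cut (inj₂ o₀) (inj₁ i₁) (inj₁ i₂) =
          cut-from (inj₁ (isolates (inner o₀) (avoid i₁) (avoid i₂)))
        cut (inj₁ i₀) (inj₂ o₁) (inj₁ i₂) =
          cut-from (inj₂ (inj₁ (isolates (inner o₁) (avoid i₀) (avoid i₂))))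
        cut (inj₁ i₀) (inj₁ i₁) (inj₂ o₂) =
          cut-from (inj₂ (inj₂ (isolates (inner o₂) (avoid i₀) (avoid i₁))))

  -- The weight left after two main branches

  -- A key of `S₁` lies in `σ₁` but not in `σ₀`, and a key of `T₂` lies in neither, so `σ₀` is
  -- nested in `σ₁` or disjoint from it. In the disjoint case the root test of `T₂` either separates
  -- the two or has a side disjoint from both, which becomes `σ₂`.
  grandchild-light : ∀ σ₀ S₀ σ₁ S₁ T₂ → Optimal (branch σ₀ S₀ (branch σ₁ S₁ T₂)) →
    weight T₂ ≤ weight S₀ + weight S₁
  grandchild-light σ₀ S₀ σ₁ S₁ (leaf k) optimal =
    Triple.leaf-light σ₀ S₀ σ₁ S₁ (leaf k) optimal refl
  grandchild-light σ₀ S₀ σ₁ S₁ (node t l r) optimal = by-cases t refl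
    where
    open Triple σ₀ S₀ σ₁ S₁ (node t l r) optimal

    by-cases : ∀ t′ → t ≡ t′ → Light
    by-cases t′ eq with some-key At₁.proper-main | key₁
    ... | q , m | p , σ₀∌p , σ₁∋p
      with nested-or-disjoint σ₀ σ₁ σ₀∌p σ₁∋p (proj₁ (key₂⇒ m)) (proj₂ (key₂⇒ m))
    by-cases _ _ | _ | _ | inj₁ σ₀⊆σ₁ = nested-light σ₀⊆σ₁
    by-cases (equalTo k) refl | _ | _ | inj₂ d₀₁ =
      let module At₂ = AtBranch (only k) l r At₁.proper-main
          q , m = some-key At₂.proper-side
          σ₀∌ , σ₁∌ = key₂⇒ (At₂.side⇒ m)
          q≡k = only⁻¹ (At₂.side⇒∋ m)
      in Quadruple.four-sides-light σ₀ S₀ σ₁ S₁ (only k) l r optimal d₀₁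
           (∌⇒disjoint-only (subst (λ k → ¬ σ₀ ∋ k) q≡k σ₀∌))
           (∌⇒disjoint-only (subst (λ k → ¬ σ₁ ∋ k) q≡k σ₁∌))
    by-cases (lessThan k) refl | _ | _ | inj₂ d₀₁ =
      cut (nested-or-disjoint σ₀ (below k) (proj₁ p∌) k∋p (proj₁ q∌) k∌q)
          (nested-or-disjoint σ₁ (below k) (proj₂ p∌) k∋p (proj₂ q∌) k∌q)
      where
      module At₂ = AtBranch (below k) l r At₁.proper-main

      k∋p = At₂.side⇒∋ (proj₂ (some-key At₂.proper-side))
      k∌q = At₂.main⇒∌ (proj₂ (some-key At₂.proper-main))
      p∌  = key₂⇒ (At₂.side⇒ (proj₂ (some-key At₂.proper-side)))
      q∌  = key₂⇒ (At₂.main⇒ (proj₂ (some-key At₂.proper-main)))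

      cut : σ₀ ⊆ below k ⊎ Disjoint σ₀ (below k) → σ₁ ⊆ below k ⊎ Disjoint σ₁ (below k) → Light
      cut (inj₁ i₀) (inj₁ i₁) =
        Quadruple.four-sides-light σ₀ S₀ σ₁ S₁ (from k) r l optimal d₀₁
          (below⇒∌from ∘ i₀) (below⇒∌from ∘ i₁)
      cut (inj₂ o₀) (inj₂ o₁) =
        Quadruple.four-sides-light σ₀ S₀ σ₁ S₁ (below k) l r optimal d₀₁ o₀ o₁
      cut (inj₁ i₀) (inj₂ o₁) = split-light {τ = below k} refl i₀ o₁
      cut (inj₂ o₀) (inj₁ i₁) = split-light {τ = from k} refl (∌below⇒from ∘ o₀) (below⇒∌from ∘ i₁)

  -- From side branches to side-weights

  -- The yes-subtree of an equal-to test is not given as a leaf; properness shows that it holds no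
  -- key but `k`, and that at most once, which bounds its weight by `w k`.
  branches⇒branch : ∀ {T S M} → Proper T → Branches T S M →
    ∃[ σ ] T ≡ branch σ S M × weight S ≤ sw T
  branches⇒branch T-proper (equalTo {k} {l} {r}) = only k , refl , weight-mono-≤ l (leaf k) l≤k
    where
    open AtBranch (only k) l r T-proper

    l≤k : ∀ q → multiplicity l q ℕ.≤ multiplicity (leaf k) q
    l≤k q with status proper-side q
    ... | inj₁ m       = subst (ℕ._≤ multiplicity (leaf k) q) (≡.sym m) z≤n
    ... | inj₂ (m , _) with refl ← only⁻¹ (side⇒∋ m) =
      ℕₚ.≤-reflexive (≡.trans m (≡.sym (multiplicity-leaf k)))
  branches⇒branch _ (sideLeft {k} l≤r)  = below k , refl , ⊓-glb ≤-refl l≤r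
  branches⇒branch _ (sideRight {k} r≤l) = from k , refl , ⊓-glb r≤l ≤-refl

  some-branches : ∀ t l r → ∃[ S ] ∃[ M ] Branches (node t l r) S M
  some-branches (equalTo k)  l r = l , r , equalTo
  some-branches (lessThan k) l r with total (weight l) (weight r)
  ... | inj₁ l≤r = l , r , sideLeft l≤r
  ... | inj₂ r≤l = r , l , sideRight r≤l

  -- Halving in an ordered field

  0≤1 : 0# ≤ 1#
  0≤1 with total 0# 1#
  ... | inj₁ 0≤1 = 0≤1
  ... | inj₂ 1≤0 = begin
    0#            ≤⟨ F.*-nonneg 0≤-1 0≤-1 ⟩
    - 1# * - 1#   ≈⟨ -1*x≈-x (- 1#) ⟩
    - (- 1#)      ≈⟨ -‿involutive 1# ⟩
    1#            ∎
    where
    0≤-1 : 0# ≤ - 1#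
    0≤-1 = begin
      0#          ≈⟨ F.-‿inverseʳ 1# ⟨
      1# + - 1#   ≤⟨ F.+-monoˡ-≤ (- 1#) 1≤0 ⟩
      0# + - 1#   ≈⟨ F.+-identityˡ (- 1#) ⟩
      - 1#        ∎

  2≉0 : ¬ 1# + 1# ≈ 0#
  2≉0 2≈0 = F.1≉0 (antisym (begin
    1#        ≈⟨ F.+-identityˡ 1# ⟨
    0# + 1#   ≤⟨ F.+-monoˡ-≤ 1# 0≤1 ⟩
    1# + 1#   ≈⟨ 2≈0 ⟩
    0#        ∎) 0≤1)

  ½*[x+x]≈x : ∀ x → ½ * (x + x) ≈ x
  ½*[x+x]≈x x = begin-equality
    ½ * (x + x)             ≈⟨ F.*-congˡ (F.+-cong (F.*-identityˡ x) (F.*-identityˡ x)) ⟨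
    ½ * (1# * x + 1# * x)   ≈⟨ F.*-congˡ (F.distribʳ x 1# 1#) ⟨
    ½ * ((1# + 1#) * x)     ≈⟨ F.*-assoc ½ (1# + 1#) x ⟨
    (½ * (1# + 1#)) * x     ≈⟨ F.*-congʳ (F.trans (F.*-comm ½ _) (F.⁻¹-inverseʳ 2≉0)) ⟩
    1# * x                  ≈⟨ F.*-identityˡ x ⟩
    x                       ∎

  -- Totality replaces the sign of `½`: if `y ≤ ½ * x`, doubling gives `y + y ≤ x`, hence equality
  -- by antisymmetry.
  ≤+⇒½*≤ : ∀ {x y} → x ≤ y + y → ½ * x ≤ y
  ≤+⇒½*≤ {x} {y} x≤2y with total (½ * x) y
  ... | inj₁ ½x≤y = ½x≤y
  ... | inj₂ y≤½x = begin
    ½ * x         ≈⟨ F.*-congˡ (antisym x≤2y 2y≤x) ⟩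
    ½ * (y + y)   ≈⟨ ½*[x+x]≈x y ⟩
    y             ∎
    where
    2y≤x : y + y ≤ x
    2y≤x = begin
      y + y           ≤⟨ +-mono-≤ y≤½x y≤½x ⟩
      ½ * x + ½ * x   ≈⟨ F.distribˡ ½ x x ⟨
      ½ * (x + x)     ≈⟨ ½*[x+x]≈x x ⟩
      x               ∎

  side-weights≥½ : ∀ {T S M S₁ T₂} → Optimal T → Branches T S M → Branches M S₁ T₂ →
    ½ * weight T ≤ sw T + sw M
  side-weights≥½ {T} {S} {M} {S₁} {T₂} optimal b₀ b₁
    with branches⇒branch (2WCST-proper {T = T} (proj₁ optimal)) b₀
  ... | σ₀ , refl , S≤sw
    with branches⇒branch (AtBranch.proper-main σ₀ S M (2WCST-proper {T = T} (proj₁ optimal))) b₁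
  ... | σ₁ , refl , S₁≤sw = ≤+⇒½*≤ (begin
    weight T                                          ≈⟨ weight-branch σ₀ S M ⟩
    weight S + weight M                               ≈⟨ F.+-congˡ (weight-branch σ₁ S₁ T₂) ⟩
    weight S + (weight S₁ + weight T₂)                ≈⟨ F.+-assoc _ _ _ ⟨
    (weight S + weight S₁) + weight T₂
      ≤⟨ +-mono-≤ ≤-refl (grandchild-light σ₀ S σ₁ S₁ T₂ optimal) ⟩
    (weight S + weight S₁) + (weight S + weight S₁)
      ≤⟨ +-mono-≤ (+-mono-≤ S≤sw S₁≤sw) (+-mono-≤ S≤sw S₁≤sw) ⟩
    (sw T + sw M) + (sw T + sw M)                     ∎)

-- Main branches that are leaves, and the conclusion

two-values : 3 ℕ.≤ n → (i j : Fin n) → ¬ (∀ q → q ≡ i ⊎ q ≡ j)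
two-values (s≤s (s≤s (s≤s _))) i j cover
  with cover zero | cover (suc zero) | cover (suc (suc zero))
... | inj₁ refl | inj₂ refl | inj₁ ()
... | inj₁ refl | inj₂ refl | inj₂ ()
... | inj₂ refl | inj₁ refl | inj₁ ()
... | inj₂ refl | inj₁ refl | inj₂ ()

theorem3p4 : ∀ {c ℓ₁ ℓ₂ : Level} (F : OrderedField c ℓ₁ ℓ₂) (n : ℕ) → 3 ℕ.≤ n →
    (w : Fin n → OrderedField.Carrier F) →
    let open OrderedField F
        open Weighted F w
    in (∀ k → 0# ≤ w k) →
       (T : Tree n) → Optimal T →
       (S M : Tree n) → Branches T S M →
       (HasLessThanRoot T → ¬ IsLeaf M) →
       ½ * weight T ≤ sw T + sw M
theorem3p4 F n 3≤n w w≥0 T optimal S (node t l r) b _ =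
  let open Rearrangement F w w≥0
      -- `sw M` is the same for either choice of side on a tie, so any branches of `M` serve.
      _ , _ , b′ = some-branches t l r
  in side-weights≥½ optimal b b′
-- A leaf has side-weight 0, so below a less-than root the bound can fail when the main leaf carries
-- nearly all the weight; the last hypothesis excludes this shape.
theorem3p4 F n 3≤n w w≥0 _ _ _ (leaf j) (Weighted.sideLeft _) ¬leaf =
  contradiction isLeaf (¬leaf lessThanRoot)
theorem3p4 F n 3≤n w w≥0 _ _ _ (leaf j) (Weighted.sideRight _) ¬leaf =
  contradiction isLeaf (¬leaf lessThanRoot)
-- Every key other than `k` would end at the leaf `j`, leaving at most two keys.
theorem3p4 F n 3≤n w w≥0 _ ((_ , correct) , _) l (leaf j) (Weighted.equalTo {k = k}) _ =
  contradiction cover (two-values 3≤n k j)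
  where
  cover : ∀ q → q ≡ k ⊎ q ≡ j
  cover q with only k ∋? q
  ... | yes only = inj₁ refl
  ... | no  ∌    = inj₂ (≡.trans (≡.sym (correct q)) (Path.search-≡ (outside {S = l} ∌ (stay {T = leaf j}))))
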